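{- Let $m\ge 2$ be an integer and let $n$ be a positive integer with $m^j\le n<m^{j+1}$ for some integer $j\ge 0$, with base $m$ representation $n=\alpha_j m^j+\cdots+\alpha_1 m+\alpha_0$ ($\alpha_j>0$, $0\le\alpha_i\le m-1$). For an $m$-ary partition $\lambda=(\lambda_\ell,\ldots,\lambda_0)$ of $n$ (so $n=\sum_{i=0}^\ell \lambda_i m^i$, $\lambda_\ell>0$, $\lambda_i\ge 0$), setting $\lambda_k=0$ for $\ell<k\le j$, define $\varphi(\lambda)=(\beta_j,\beta_{j-1},\ldots,\beta_1)$ by \[ \beta_i=\sum_{k=i}^{j}m^{k-i}(\alpha_k-\lambda_k),\qquad 1\le i\le j. \] Then $\varphi$ is a bijection from the set $\mathcal{B}_m(n)$ of $m$-ary partitions of $n$ onto the set \[ \mathcal{S}_m(n)=\{(\beta_j,\ldots,\beta_1)\in\mathbb{Z}^j:\,0\le\beta_j\le\alpha_j\text{ and }0\le\beta_t\le\alpha_t+m\beta_{t+1}\text{ for }1\le t\le j-1\}. \]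
   Context: An $m$-ary partition of $n$ is a partition of $n$ into powers of $m$, encoded as the sequence $(\lambda_\ell,\ldots,\lambda_0)$ of multiplicities, where $\lambda_i$ is the number of parts equal to $m^i$, $\lambda_\ell>0$ and $\lambda_i\ge0$; necessarily $\ell\le j$. $\mathcal{B}_m(n)$ is the set of all such partitions. -}

module Defs where

open import Data.Integer as ℤ using (ℤ; +_; 0ℤ)
open import Data.Fin using (toℕ)
open import Data.List using (applyUpTo; foldr)
open import Data.Nat using (ℕ; zero; suc; _+_; _*_; _∸_; _^_; _<_; _≤_)
open import Data.Nat.ListAction using (sum)
open import Data.Product using (_×_)
open import Data.Vec using (Vec; []; _∷_; tabulate)
open import Relation.Binary.PropositionalEquality using (_≡_)
open import Relation.Unary using (Pred)
open import Level using (0ℓ)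

-- All finite sequences are stored in order of increasing index: the tuple
-- written (x_ℓ , … , x₀) on paper is the vector x₀ ∷ … ∷ x_ℓ ∷ [], and
-- (β_j , … , β₁) is β₁ ∷ … ∷ β_j ∷ [].

lookupOr : ∀ {A : Set} {n} → A → Vec A n → ℕ → A
lookupOr d []       _       = d
lookupOr d (x ∷ xs) zero    = x
lookupOr d (x ∷ xs) (suc i) = lookupOr d xs i

infixl 9 _‼_ _‼₁_

-- The default 0 implements the convention λ_k = 0 for k > ℓ.
_‼_ : ∀ {n} → Vec ℕ n → ℕ → ℕ
x ‼ k = lookupOr 0 x k

-- Indexing from 1; used below only with 1 ≤ t ≤ j, where the default and the
-- truncation of t ∸ 1 play no role.
_‼₁_ : ∀ {j} → Vec ℤ j → ℕ → ℤ
β ‼₁ t = lookupOr 0ℤ β (t ∸ 1)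

-- Σ[ a ⋯ b ] f = f a + f (a + 1) + … + f b, and 0 when a > b.
Σ[_⋯_] : ℕ → ℕ → (ℕ → ℤ) → ℤ
Σ[ a ⋯ b ] f = foldr ℤ._+_ 0ℤ (applyUpTo (λ d → f (a + d)) (suc b ∸ a))

-- eval m (x₀ ∷ … ∷ x_ℓ ∷ []) = Σ_{i=0}^{ℓ} x_i m^i
eval : ∀ {ℓ} → ℕ → Vec ℕ (suc ℓ) → ℕ
eval {ℓ} m x = sum (applyUpTo (λ i → x ‼ i * m ^ i) (suc ℓ))

-- The two proof fields are mere propositions, so _≡_ on 𝓑 m n amounts to
-- equality of the multiplicity sequences.
record 𝓑 (m n : ℕ) : Set where
  field
    ℓ         : ℕ
    mult      : Vec ℕ (suc ℓ)
    leading>0 : 0 < mult ‼ ℓ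
    total     : n ≡ eval m mult

record IsBaseRepresentation (m n : ℕ) {j : ℕ} (α : Vec ℕ (suc j)) : Set where
  field
    leading>0 : 0 < α ‼ j
    digit     : ∀ i → i ≤ j → α ‼ i ≤ m ∸ 1
    total     : n ≡ eval m α

φ : ∀ {m n j} → Vec ℕ (suc j) → 𝓑 m n → Vec ℤ j
φ {m} {n} {j} α p = tabulate (λ i → β (suc (toℕ i)))
  where
  open 𝓑 p

  β : ℕ → ℤ
  β i = Σ[ i ⋯ j ] (λ k → + (m ^ (k ∸ i)) ℤ.* (+ (α ‼ k) ℤ.- + (mult ‼ k)))

-- For j = 0 there is no coordinate β_j, and the set is ℤ⁰, a single point.
𝓢 : ∀ {j} → ℕ → Vec ℕ (suc j) → Pred (Vec ℤ j) 0ℓ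
𝓢 {j} m α β =
  (1 ≤ j → 0ℤ ℤ.≤ β ‼₁ j × β ‼₁ j ℤ.≤ + (α ‼ j)) ×
  (∀ t → 1 ≤ t → t < j →
     0ℤ ℤ.≤ β ‼₁ t × β ‼₁ t ℤ.≤ + (α ‼ t) ℤ.+ + m ℤ.* β ‼₁ suc t)

{-# OPTIONS --safe #-}
-- With δ k = α k − λ k, the sums β i = Σ_{k=i}^{j} m^{k−i} δ k are the carries of
-- a Horner scheme: they are the only solution of β (j + 1) = 0 and
-- β i = δ i + m β (i + 1). That λ and α evaluate to the same n says β 0 = 0.
-- Since α i < m, the recurrence propagates 0 ≤ β i to 0 ≤ β (i + 1), and λ i ≥ 0
-- is the upper bound defining 𝓢. Conversely β, with β 0 = β (j + 1) = 0,
-- determines λ by λ i = α i + m β (i + 1) − β i.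
module Submission where

open import Defs
open import Data.Empty using (⊥-elim)
open import Data.Fin using (toℕ)
open import Data.Integer as ℤ using (ℤ; +_; -[1+_]; 0ℤ; ∣_∣)
import Data.Integer.Properties as ℤ
import Data.Integer.Tactic.RingSolver as ℤSolver
open import Data.List using (applyUpTo; foldr)
open import Data.Nat using (ℕ; zero; suc; _+_; _*_; _∸_; _^_; _≤_; _<_; z≤n; s≤s; NonZero; >-nonZero)
open import Data.Nat.ListAction using (sum)
open import Data.Nat.Properties
open import Data.Product using (Σ; ∃; _×_; _,_; proj₁; proj₂)
open import Data.Sum using (_⊎_; inj₁; inj₂)
open import Data.Vec using (Vec; []; _∷_; tabulate)
open import Function using (_on_; _∘_)
open import Function.Definitions using (Bijective)
open import Relation.Binary.Definitions using (tri<; tri≈; tri>)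
open import Relation.Binary.PropositionalEquality
open import Relation.Nullary using (yes; no)
open import Relation.Unary using (_∈_)

-- Vectors with a default entry, and finite sums.

lookupOr-≥ : ∀ {A : Set} {n} (d : A) (xs : Vec A n) {i} → n ≤ i → lookupOr d xs i ≡ d
lookupOr-≥ d []       _         = refl
lookupOr-≥ d (x ∷ xs) (s≤s n≤i) = lookupOr-≥ d xs n≤i

lookupOr-tabulate : ∀ {A : Set} {n} (d : A) (f : ℕ → A) {i} → i < n →
  lookupOr d (tabulate {n = n} (f ∘ toℕ)) i ≡ f i
lookupOr-tabulate {n = suc n} d f {zero}  _         = refl
lookupOr-tabulate {n = suc n} d f {suc i} (s≤s i<n) = lookupOr-tabulate d (f ∘ suc) i<n

lookupOr-injective : ∀ {A : Set} {n} (d : A) (xs ys : Vec A n) →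
  (∀ i → lookupOr d xs i ≡ lookupOr d ys i) → xs ≡ ys
lookupOr-injective d []       []       eq = refl
lookupOr-injective d (x ∷ xs) (y ∷ ys) eq =
  cong₂ _∷_ (eq 0) (lookupOr-injective d xs ys (eq ∘ suc))

sum-applyUpTo-zero : ∀ {f : ℕ → ℕ} n → (∀ k → k < n → f k ≡ 0) → sum (applyUpTo f n) ≡ 0
sum-applyUpTo-zero zero    f≡0 = refl
sum-applyUpTo-zero (suc n) f≡0 =
  cong₂ _+_ (f≡0 0 (s≤s z≤n)) (sum-applyUpTo-zero n (λ k k<n → f≡0 (suc k) (s≤s k<n)))

sum-applyUpTo-extend : ∀ {f : ℕ → ℕ} {n n′} → n ≤ n′ → (∀ k → n ≤ k → k < n′ → f k ≡ 0) →
  sum (applyUpTo f n) ≡ sum (applyUpTo f n′)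
sum-applyUpTo-extend {n′ = n′} z≤n f≡0 = sym (sum-applyUpTo-zero n′ (λ k → f≡0 k z≤n))
sum-applyUpTo-extend {f} (s≤s n≤n′) f≡0 =
  cong (λ s → f 0 + s) (sum-applyUpTo-extend n≤n′ (λ k n≤k k<n′ → f≡0 (suc k) (s≤s n≤k) (s≤s k<n′)))

sum-applyUpTo-cong : ∀ {f g : ℕ → ℕ} n → (∀ k → k < n → f k ≡ g k) →
  sum (applyUpTo f n) ≡ sum (applyUpTo g n)
sum-applyUpTo-cong zero    f≡g = refl
sum-applyUpTo-cong (suc n) f≡g =
  cong₂ _+_ (f≡g 0 (s≤s z≤n)) (sum-applyUpTo-cong n (λ k k<n → f≡g (suc k) (s≤s k<n)))

term≤sum-applyUpTo : ∀ (f : ℕ → ℕ) {i n} → i < n → f i ≤ sum (applyUpTo f n)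
term≤sum-applyUpTo f {zero}  (s≤s _)   = m≤m+n _ _
term≤sum-applyUpTo f {suc i} (s≤s i<n) =
  ≤-trans (term≤sum-applyUpTo (f ∘ suc) i<n) (m≤n+m _ (f 0))

foldr-+-applyUpTo-* : ∀ c {f g : ℕ → ℤ} n → (∀ k → f k ≡ c ℤ.* g k) →
  foldr ℤ._+_ 0ℤ (applyUpTo f n) ≡ c ℤ.* foldr ℤ._+_ 0ℤ (applyUpTo g n)
foldr-+-applyUpTo-* c zero    f≡cg = sym (ℤ.*-zeroʳ c)
foldr-+-applyUpTo-* c (suc n) f≡cg =
  trans (cong₂ ℤ._+_ (f≡cg 0) (foldr-+-applyUpTo-* c n (f≡cg ∘ suc)))
        (sym (ℤ.*-distribˡ-+ c _ _))

foldr-+-applyUpTo-difference : ∀ {f : ℕ → ℤ} {a b : ℕ → ℕ} n →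
  (∀ k → f k ≡ + a k ℤ.- + b k) →
  foldr ℤ._+_ 0ℤ (applyUpTo f n) ≡ + sum (applyUpTo a n) ℤ.- + sum (applyUpTo b n)
foldr-+-applyUpTo-difference zero f≡a-b = refl
foldr-+-applyUpTo-difference {a = a} {b} (suc n) f≡a-b =
  trans (cong₂ ℤ._+_ (f≡a-b 0) (foldr-+-applyUpTo-difference {a = a ∘ suc} {b ∘ suc} n (f≡a-b ∘ suc)))
        (regroup (+ a 0) (+ b 0) (+ sum (applyUpTo (a ∘ suc) n)) (+ sum (applyUpTo (b ∘ suc) n)))
  where
  regroup : ∀ a b c d → (a ℤ.- b) ℤ.+ (c ℤ.- d) ≡ (a ℤ.+ c) ℤ.- (b ℤ.+ d)
  regroup = ℤSolver.solve-∀

-- Finds where to cut a sequence of multiplicities so that its leading entry is positive, as `𝓑`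
-- demands.
lastPositive : ∀ (x : ℕ → ℕ) n → (∀ k → k < n → x k ≡ 0) ⊎
  ∃ λ ℓ → ℓ < n × 0 < x ℓ × (∀ k → ℓ < k → k < n → x k ≡ 0)
lastPositive x zero = inj₁ (λ _ ())
lastPositive x (suc n) with x n in xn≡
... | suc _ = inj₂ (n , ≤-refl , subst (0 <_) (sym xn≡) (s≤s z≤n) ,
                    λ k n<k k≤n → ⊥-elim (<⇒≱ n<k (≤-pred k≤n)))
... | zero with lastPositive x n
...   | inj₁ x≡0 = inj₁ λ k k≤n → below-or-top k (m≤n⇒m<n∨m≡n (≤-pred k≤n))
  where
  below-or-top : ∀ k → k < n ⊎ k ≡ n → x k ≡ 0
  below-or-top k (inj₁ k<n)  = x≡0 k k<n
  below-or-top k (inj₂ refl) = xn≡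
...   | inj₂ (ℓ , ℓ<n , 0<xℓ , x≡0) =
  inj₂ (ℓ , m≤n⇒m≤1+n ℓ<n , 0<xℓ ,
        λ k ℓ<k k≤n → below-or-top k ℓ<k (m≤n⇒m<n∨m≡n (≤-pred k≤n)))
  where
  below-or-top : ∀ k → ℓ < k → k < n ⊎ k ≡ n → x k ≡ 0
  below-or-top k ℓ<k (inj₁ k<n)  = x≡0 k ℓ<k k<n
  below-or-top k ℓ<k (inj₂ refl) = xn≡

-- Carries and their recurrence.

-- The local `β` of `φ`, with an arbitrary `δ` in place of the difference of digits and
-- multiplicities. The index may also be 0 or exceed `j`; these values are the boundary conditions
-- of the recurrence.
carry : ℕ → ℕ → (ℕ → ℤ) → ℕ → ℤ
carry m j δ i = Σ[ i ⋯ j ] (λ k → + (m ^ (k ∸ i)) ℤ.* δ k)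

carry->j : ∀ m {j} δ {i} → j < i → carry m j δ i ≡ 0ℤ
carry->j m δ {i} j<i rewrite m≤n⇒m∸n≡0 j<i = refl

-- The summand at `k = i` has weight 1, and every later one contains a factor `m`. The rewrite
-- exposes the first summand by turning `suc j ∸ i` into `suc (j ∸ i)`.
carry-step : ∀ m {j} δ {i} → i ≤ j →
  carry m j δ i ≡ δ i ℤ.+ + m ℤ.* carry m j δ (suc i)
carry-step m {j} δ {i} i≤j rewrite +-∸-assoc 1 i≤j =
  cong₂ ℤ._+_ first (foldr-+-applyUpTo-* (+ m) (j ∸ i) rest)
  where
  first : + (m ^ (i + 0 ∸ i)) ℤ.* δ (i + 0) ≡ δ i
  first rewrite +-identityʳ i | n∸n≡0 i = ℤ.*-identityˡ (δ i)

  rest : ∀ d → + (m ^ (i + suc d ∸ i)) ℤ.* δ (i + suc d) ≡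
               + m ℤ.* (+ (m ^ (i + d ∸ i)) ℤ.* δ (suc i + d))
  rest d rewrite m+n∸m≡n i (suc d) | m+n∸m≡n i d | +-suc i d =
    trans (cong (ℤ._* δ (suc (i + d))) (ℤ.pos-* m (m ^ d)))
          (ℤ.*-assoc (+ m) (+ (m ^ d)) (δ (suc (i + d))))

carry-unique : ∀ m j δ (b : ℕ → ℤ) → b (suc j) ≡ 0ℤ →
  (∀ i → i ≤ j → b i ≡ δ i ℤ.+ + m ℤ.* b (suc i)) →
  ∀ i → i ≤ suc j → carry m j δ i ≡ b i
carry-unique m j δ b b-end b-step i i≤1+j = descend (suc j ∸ i) i (m+[n∸m]≡n i≤1+j)
  where
  -- The recurrence runs downwards from `suc j`, so the induction is on the distance `d` to that
  -- index.
  descend : ∀ d i → i + d ≡ suc j → carry m j δ i ≡ b i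
  descend zero i eq rewrite trans (sym (+-identityʳ i)) eq =
    trans (carry->j m {j} δ ≤-refl) (sym b-end)
  descend (suc d) i eq = begin
    carry m j δ i                           ≡⟨ carry-step m δ i≤j ⟩
    δ i ℤ.+ + m ℤ.* carry m j δ (suc i)     ≡⟨ cong (λ z → δ i ℤ.+ + m ℤ.* z) (descend d (suc i) 1+i+d≡) ⟩
    δ i ℤ.+ + m ℤ.* b (suc i)               ≡⟨ b-step i i≤j ⟨
    b i                                     ∎
    where
    open ≡-Reasoning
    1+i+d≡ : suc i + d ≡ suc j
    1+i+d≡ = trans (sym (+-suc i d)) eq
    i≤j : i ≤ j
    i≤j = ≤-trans (m≤m+n i d) (≤-reflexive (suc-injective 1+i+d≡))

-- At index 0 the weights are the place values `m ^ k` themselves, so this carry vanishes exactly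
-- when the two sequences evaluate to the same number.
carry-zero : ∀ m j (a b : ℕ → ℕ) → carry m j (λ k → + a k ℤ.- + b k) 0 ≡
  + sum (applyUpTo (λ k → a k * m ^ k) (suc j)) ℤ.- + sum (applyUpTo (λ k → b k * m ^ k) (suc j))
carry-zero m j a b = foldr-+-applyUpTo-difference {a = λ k → a k * m ^ k} {λ k → b k * m ^ k} (suc j) λ k →
  trans (distribute (+ (m ^ k)) (+ a k) (+ b k))
        (sym (cong₂ ℤ._-_ (ℤ.pos-* (a k) (m ^ k)) (ℤ.pos-* (b k) (m ^ k))))
  where
  distribute : ∀ c x y → c ℤ.* (x ℤ.- y) ≡ x ℤ.* c ℤ.- y ℤ.* c
  distribute = ℤSolver.solve-∀

-- A negative `b` is at most -1, so the hypothesis would force `m ≤ l + m * suc k ≤ a`, against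
-- `a < m`.
carry-nonneg-step : ∀ {m a l} b → a < m →
  0ℤ ℤ.≤ (+ a ℤ.- + l) ℤ.+ + m ℤ.* b → 0ℤ ℤ.≤ b
carry-nonneg-step (+ _) _ _ = ℤ.+≤+ z≤n
carry-nonneg-step {m} {a} {l} -[1+ k ] a<m 0≤ = ⊥-elim (<⇒≱ a<m m≤a)
  where
  collect : ∀ a l m b → (a ℤ.- l) ℤ.+ m ℤ.* (ℤ.- b) ≡ a ℤ.- (l ℤ.+ m ℤ.* b)
  collect = ℤSolver.solve-∀

  l+m[1+k]≤a : l + m * suc k ≤ a
  l+m[1+k]≤a = ℤ.drop‿+≤+ (subst (ℤ._≤ + a)
    (cong (λ z → + l ℤ.+ z) (sym (ℤ.pos-* m (suc k))))
    (ℤ.0≤i-j⇒j≤i (subst (0ℤ ℤ.≤_) (collect (+ a) (+ l) (+ m) (+ suc k)) 0≤)))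

  m≤a : m ≤ a
  m≤a = ≤-trans (m≤m*n m (suc k)) (≤-trans (m≤n+m (m * suc k) l) l+m[1+k]≤a)

-- Partitions as multiplicity sequences.

-- The lengths agree as well: otherwise the positive leading entry of the longer sequence would
-- equal the default 0 of the shorter one.
𝓑-≡ : ∀ {m n} (p q : 𝓑 m n) →
  (∀ k → 𝓑.mult p ‼ k ≡ 𝓑.mult q ‼ k) → p ≡ q
𝓑-≡ p q agree with <-cmp (𝓑.ℓ p) (𝓑.ℓ q)
... | tri< ℓ<ℓ′ _ _ = ⊥-elim (<-irrefl
  (sym (trans (sym (agree (𝓑.ℓ q))) (lookupOr-≥ 0 (𝓑.mult p) ℓ<ℓ′))) (𝓑.leading>0 q))
... | tri> _ _ ℓ′<ℓ = ⊥-elim (<-irrefl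
  (sym (trans (agree (𝓑.ℓ p)) (lookupOr-≥ 0 (𝓑.mult q) ℓ′<ℓ))) (𝓑.leading>0 p))
𝓑-≡ record { mult = x ; leading>0 = x>0 ; total = xt }
    record { mult = y ; leading>0 = y>0 ; total = yt } agree | tri≈ _ refl _
  with lookupOr-injective 0 x y agree
... | refl with ≤-irrelevant x>0 y>0 | ≡-irrelevant xt yt
... | refl | refl = refl

-- If `j < ℓ`, a single part `m ^ ℓ` would already exceed `n`.
ℓ≤j : ∀ {m n j} → 2 ≤ m → n < m ^ suc j → (p : 𝓑 m n) → 𝓑.ℓ p ≤ j
ℓ≤j {m} {n} {j} 2≤m n<m^1+j p = ≮⇒≥ λ j<ℓ → <-irrefl refl (begin-strict
  n                      <⟨ n<m^1+j ⟩
  m ^ suc j              ≤⟨ ^-monoʳ-≤ m j<ℓ ⟩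
  m ^ ℓ                  ≤⟨ m≤n*m (m ^ ℓ) (mult ‼ ℓ) ⟩
  mult ‼ ℓ * m ^ ℓ       ≤⟨ term≤sum-applyUpTo (λ i → mult ‼ i * m ^ i) (n<1+n ℓ) ⟩
  eval m mult            ≡⟨ total ⟨
  n                      ∎)
  where
  open 𝓑 p
  open ≤-Reasoning
  instance
    m≢0 : NonZero m
    m≢0 = >-nonZero (<⇒≤ 2≤m)
    leading≢0 : NonZero (mult ‼ ℓ)
    leading≢0 = >-nonZero leading>0

eval-extend : ∀ m {ℓ j} (x : Vec ℕ (suc ℓ)) → ℓ ≤ j →
  eval m x ≡ sum (applyUpTo (λ i → x ‼ i * m ^ i) (suc j))
eval-extend m x ℓ≤j = sum-applyUpTo-extend (s≤s ℓ≤j)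
  λ k ℓ<k _ → cong (_* m ^ k) (lookupOr-≥ 0 x ℓ<k)

-- The inequalities of `𝓢` in uniform form.

-- β preceded by β 0 = 0; lookupOr supplies β (j + 1) = 0.
extend : ∀ {j} → Vec ℤ j → ℕ → ℤ
extend β zero    = 0ℤ
extend β (suc i) = lookupOr 0ℤ β i

-- With zeros at both ends, the separate condition on the top coordinate becomes the case `i = j` of
-- the general one, and `i = 0` can join the induction.
record IsAdmissible (m : ℕ) {j} (α : Vec ℕ (suc j)) (b : ℕ → ℤ) : Set where
  field
    nonneg : ∀ i → i ≤ j → 0ℤ ℤ.≤ b i
    bound  : ∀ i → i ≤ j → b i ℤ.≤ + (α ‼ i) ℤ.+ + m ℤ.* b (suc i)

module _ {m j : ℕ} {α : Vec ℕ (suc j)} {β : Vec ℤ j} where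

  bound-top : + (α ‼ j) ℤ.+ + m ℤ.* extend β (suc j) ≡ + (α ‼ j)
  bound-top rewrite lookupOr-≥ 0ℤ β (≤-refl {j}) | ℤ.*-zeroʳ (+ m) = ℤ.+-identityʳ _

  admissible⇒𝓢 : IsAdmissible m α (extend β) → β ∈ 𝓢 m α
  admissible⇒𝓢 adm = top , below
    where
    open IsAdmissible adm

    ‼₁≡extend : ∀ {t} → 1 ≤ t → extend β t ≡ β ‼₁ t
    ‼₁≡extend {suc t} _ = refl

    top : 1 ≤ j → 0ℤ ℤ.≤ β ‼₁ j × β ‼₁ j ℤ.≤ + (α ‼ j)
    top 1≤j = subst (λ z → 0ℤ ℤ.≤ z × z ℤ.≤ + (α ‼ j)) (‼₁≡extend 1≤j)
      (nonneg j ≤-refl , subst (extend β j ℤ.≤_) bound-top (bound j ≤-refl))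

    below : ∀ t → 1 ≤ t → t < j →
      0ℤ ℤ.≤ β ‼₁ t × β ‼₁ t ℤ.≤ + (α ‼ t) ℤ.+ + m ℤ.* β ‼₁ suc t
    below (suc t) _ t<j = nonneg (suc t) (<⇒≤ t<j) , bound (suc t) (<⇒≤ t<j)

  𝓢⇒admissible : β ∈ 𝓢 m α → IsAdmissible m α (extend β)
  𝓢⇒admissible (top , below) = record { nonneg = λ i _ → nonneg i ; bound = bound }
    where
    both : ∀ i → suc i ≤ j → 0ℤ ℤ.≤ extend β (suc i) ×
      extend β (suc i) ℤ.≤ + (α ‼ suc i) ℤ.+ + m ℤ.* extend β (suc (suc i))
    both i 1+i≤j with m≤n⇒m<n∨m≡n 1+i≤j
    ... | inj₁ 1+i<j = below (suc i) (s≤s z≤n) 1+i<j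
    ... | inj₂ refl  = proj₁ (top (s≤s z≤n)) ,
                       subst (extend β j ℤ.≤_) (sym bound-top) (proj₂ (top (s≤s z≤n)))

    -- Proved for every `i`, since `bound zero` calls for index 1, which lies beyond `j` when
    -- `j = 0`; there the default 0 answers.
    nonneg : ∀ i → 0ℤ ℤ.≤ extend β i
    nonneg zero = ℤ.≤-refl
    nonneg (suc i) with suc i ≤? j
    ... | yes 1+i≤j = proj₁ (both i 1+i≤j)
    ... | no  1+i≰j = ℤ.≤-reflexive (sym (lookupOr-≥ 0ℤ β (≤-pred (≰⇒> 1+i≰j))))

    bound : ∀ i → i ≤ j → extend β i ℤ.≤ + (α ‼ i) ℤ.+ + m ℤ.* extend β (suc i)
    -- This inequality is not among those of `𝓢`; both terms on its right are nonnegative.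
    bound zero _ = ℤ.+-mono-≤ {0ℤ} {+ (α ‼ 0)} (ℤ.+≤+ z≤n)
      (subst (ℤ._≤ + m ℤ.* extend β 1) (ℤ.*-zeroʳ (+ m))
             (ℤ.*-monoˡ-≤-nonNeg (+ m) (nonneg 1)))
    bound (suc i) 1+i≤j = proj₂ (both i 1+i≤j)

-- The map `φ` and its inverse.

module _ {m n j : ℕ} (2≤m : 2 ≤ m) (0<n : 0 < n) (n<m^1+j : n < m ^ suc j)
         (α : Vec ℕ (suc j)) (rep : IsBaseRepresentation m n α) where

  open IsBaseRepresentation rep using (digit) renaming (total to α-total)

  difference : 𝓑 m n → ℕ → ℤ
  difference p k = + (α ‼ k) ℤ.- + (𝓑.mult p ‼ k)

  -- At 0 the carry is `n - n`, from 1 to `j` this is the definition of `φ`, and beyond `j` both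
  -- sides are 0.
  extend-φ : ∀ p i → extend (φ α p) i ≡ carry m j (difference p) i
  extend-φ p zero = sym (begin
    carry m j (difference p) 0  ≡⟨ carry-zero m j (α ‼_) (mult ‼_) ⟩
    + eval m α ℤ.- + sum (applyUpTo (λ k → mult ‼ k * m ^ k) (suc j))
                                ≡⟨ cong₂ (λ a b → + a ℤ.- + b) α-total
                                     (trans total (eval-extend m {j = j} mult (ℓ≤j 2≤m n<m^1+j p))) ⟨
    + n ℤ.- + n                 ≡⟨ ℤ.+-inverseʳ (+ n) ⟩
    0ℤ                          ∎)
    where
    open 𝓑 p
    open ≡-Reasoning
  extend-φ p (suc i) with i <? j
  ... | yes i<j = lookupOr-tabulate 0ℤ (carry m j (difference p) ∘ suc) i<j
  ... | no  i≮j = trans (lookupOr-≥ 0ℤ (φ α p) (≮⇒≥ i≮j))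
                        (sym (carry->j m (difference p) (s≤s (≮⇒≥ i≮j))))

  extend-φ-step : ∀ p {i} → i ≤ j →
    extend (φ α p) i ≡ difference p i ℤ.+ + m ℤ.* extend (φ α p) (suc i)
  extend-φ-step p {i} i≤j rewrite extend-φ p i | extend-φ p (suc i) =
    carry-step m (difference p) i≤j

  φ-admissible : ∀ p → IsAdmissible m α (extend (φ α p))
  φ-admissible p = record { nonneg = nonneg ; bound = bound }
    where
    open 𝓑 p

    nonneg : ∀ i → i ≤ j → 0ℤ ℤ.≤ extend (φ α p) i
    nonneg zero    _     = ℤ.≤-refl
    -- Nonnegativity climbs from index 0, against the direction in which the carries are computed.
    nonneg (suc i) 1+i≤j = carry-nonneg-step {m} {α ‼ i} {mult ‼ i} _ α<m
      (subst (0ℤ ℤ.≤_) (extend-φ-step p i≤j) (nonneg i i≤j))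
      where
      i≤j : i ≤ j
      i≤j = <⇒≤ 1+i≤j
      α<m : α ‼ i < m
      α<m = ≤-trans (s≤s (digit i i≤j)) (≤-reflexive (m+[n∸m]≡n (<⇒≤ 2≤m)))

    bound : ∀ i → i ≤ j →
      extend (φ α p) i ℤ.≤ + (α ‼ i) ℤ.+ + m ℤ.* extend (φ α p) (suc i)
    bound i i≤j = subst (ℤ._≤ + (α ‼ i) ℤ.+ + m ℤ.* extend (φ α p) (suc i))
      (sym (extend-φ-step p i≤j))
      (ℤ.+-monoˡ-≤ (+ m ℤ.* extend (φ α p) (suc i)) (ℤ.i-j≤i (+ (α ‼ i)) (+ (mult ‼ i))))

  -- The recurrence solved for the multiplicity, which is thus recovered from `φ α p`.
  mult-from-φ : ∀ p {i} → i ≤ j → + (𝓑.mult p ‼ i) ≡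
    + (α ‼ i) ℤ.+ + m ℤ.* extend (φ α p) (suc i) ℤ.- extend (φ α p) i
  mult-from-φ p {i} i≤j = trans (cancel (+ (α ‼ i)) _ (+ m ℤ.* extend (φ α p) (suc i)))
    (cong (λ z → + (α ‼ i) ℤ.+ + m ℤ.* extend (φ α p) (suc i) ℤ.- z) (sym (extend-φ-step p i≤j)))
    where
    cancel : ∀ a l c → l ≡ a ℤ.+ c ℤ.- ((a ℤ.- l) ℤ.+ c)
    cancel = ℤSolver.solve-∀

  φ-injective : ∀ p q → φ α p ≡ φ α q → p ≡ q
  φ-injective p q φp≡φq = 𝓑-≡ p q agree
    where
    beyond : ∀ r {k} → j < k → 𝓑.mult r ‼ k ≡ 0
    beyond r j<k = lookupOr-≥ 0 (𝓑.mult r) (≤-<-trans (ℓ≤j 2≤m n<m^1+j r) j<k)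

    agree : ∀ k → 𝓑.mult p ‼ k ≡ 𝓑.mult q ‼ k
    agree k with k ≤? j
    ... | no  k≰j = trans (beyond p (≰⇒> k≰j)) (sym (beyond q (≰⇒> k≰j)))
    ... | yes k≤j = ℤ.+-injective (trans (mult-from-φ p k≤j) (trans
      (cong (λ β → + (α ‼ k) ℤ.+ + m ℤ.* extend β (suc k) ℤ.- extend β k) φp≡φq)
      (sym (mult-from-φ q k≤j))))

  -- Zeros above the last positive entry are cut off; such an entry exists because `0 < n`.
  fromMultiplicities : (x : ℕ → ℕ) → n ≡ sum (applyUpTo (λ k → x k * m ^ k) (suc j)) →
    Σ (𝓑 m n) λ p → ∀ k → k ≤ j → 𝓑.mult p ‼ k ≡ x k
  fromMultiplicities x n≡ with lastPositive x (suc j)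
  ... | inj₁ x≡0 = ⊥-elim (<⇒≢ 0<n (sym (trans n≡
    (sum-applyUpTo-zero (suc j) λ k k≤j → cong (_* m ^ k) (x≡0 k k≤j)))))
  ... | inj₂ (ℓ , s≤s ℓ≤j , 0<xℓ , x≡0) = record
      { ℓ = ℓ
      ; mult = mult
      ; leading>0 = subst (0 <_) (sym (mult≡x ℓ ℓ≤j)) 0<xℓ
      ; total = trans n≡ (trans
          (sum-applyUpTo-cong (suc j) λ k k≤j → cong (_* m ^ k) (sym (mult≡x k (≤-pred k≤j))))
          (sym (eval-extend m mult ℓ≤j)))
      } , mult≡x
    where
    mult : Vec ℕ (suc ℓ)
    mult = tabulate (x ∘ toℕ)

    mult≡x : ∀ k → k ≤ j → mult ‼ k ≡ x k
    mult≡x k k≤j with k ≤? ℓ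
    ... | yes k≤ℓ = lookupOr-tabulate 0 x (s≤s k≤ℓ)
    ... | no  k≰ℓ = trans (lookupOr-≥ 0 mult (≰⇒> k≰ℓ)) (sym (x≡0 k (≰⇒> k≰ℓ) (s≤s k≤j)))

  φ-unique : ∀ p (β : Vec ℤ j) →
    (∀ i → i ≤ j → extend β i ≡ difference p i ℤ.+ + m ℤ.* extend β (suc i)) → φ α p ≡ β
  φ-unique p β β-step = lookupOr-injective 0ℤ (φ α p) β φp≡β
    where
    φp≡β : ∀ i → lookupOr 0ℤ (φ α p) i ≡ lookupOr 0ℤ β i
    φp≡β i with i <? j
    ... | yes i<j = trans (extend-φ p (suc i))
      (carry-unique m j (difference p) (extend β) (lookupOr-≥ 0ℤ β (≤-refl {j})) β-step (suc i) (m≤n⇒m≤1+n i<j))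
    ... | no  i≮j = trans (lookupOr-≥ 0ℤ (φ α p) (≮⇒≥ i≮j))
                          (sym (lookupOr-≥ 0ℤ β (≮⇒≥ i≮j)))

  φ-surjective : ∀ β → IsAdmissible m α (extend β) → Σ (𝓑 m n) λ p → φ α p ≡ β
  φ-surjective β adm = recover (fromMultiplicities x n≡)
    where
    open IsAdmissible adm

    -- The formula of `mult-from-φ`. By `bound` the integer is nonnegative for `i ≤ j`, so there the
    -- absolute value only moves it to `ℕ`.
    x : ℕ → ℕ
    x i = ∣ + (α ‼ i) ℤ.+ + m ℤ.* extend β (suc i) ℤ.- extend β i ∣

    β-step : ∀ i → i ≤ j → extend β i ≡ (+ (α ‼ i) ℤ.- + x i) ℤ.+ + m ℤ.* extend β (suc i)
    β-step i i≤j
      rewrite ℤ.0≤i⇒+∣i∣≡i (ℤ.i≤j⇒0≤j-i (bound i i≤j)) =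
      cancel (+ (α ‼ i)) (extend β i) (+ m ℤ.* extend β (suc i))
      where
      cancel : ∀ a b c → b ≡ (a ℤ.- (a ℤ.+ c ℤ.- b)) ℤ.+ c
      cancel = ℤSolver.solve-∀

    β-end : extend β (suc j) ≡ 0ℤ
    β-end = lookupOr-≥ 0ℤ β ≤-refl

    -- By uniqueness the carry of `α` minus `x` at 0 is `extend β 0`, which is 0; hence `x`
    -- evaluates to `n`, as `α` does.
    n≡ : n ≡ sum (applyUpTo (λ k → x k * m ^ k) (suc j))
    n≡ = trans α-total (ℤ.+-injective (ℤ.i-j≡0⇒i≡j _ _
      (trans (sym (carry-zero m j (α ‼_) x))
             (carry-unique m j (λ k → + (α ‼ k) ℤ.- + x k) (extend β) β-end β-step 0 z≤n))))

    recover : (Σ (𝓑 m n) λ p → ∀ k → k ≤ j → 𝓑.mult p ‼ k ≡ x k) → Σ (𝓑 m n) λ p → φ α p ≡ β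
    recover (p , mult≡x) = p , φ-unique p β λ i i≤j → trans (β-step i i≤j)
      (cong (λ l → (+ (α ‼ i) ℤ.- + l) ℤ.+ + m ℤ.* extend β (suc i)) (sym (mult≡x i i≤j)))

theorem2p2 : (m n j : ℕ) → 2 ≤ m → 0 < n → m ^ j ≤ n → n < m ^ suc j →
    (α : Vec ℕ (suc j)) → IsBaseRepresentation m n α →
    Σ ((p : 𝓑 m n) → φ α p ∈ 𝓢 m α) (λ φ∈𝓢 →
    Bijective {A = 𝓑 m n} {B = Σ (Vec ℤ j) (𝓢 m α)} _≡_ (_≡_ on proj₁)
    (λ p → φ α p , φ∈𝓢 p))
theorem2p2 m n j 2≤m 0<n _ n<m^1+j α rep =
  (λ p → admissible⇒𝓢 (φ-admissible 2≤m 0<n n<m^1+j α rep p)) ,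
  (λ {p} {q} → φ-injective 2≤m 0<n n<m^1+j α rep p q) ,
  λ (β , β∈𝓢) →
    let p , φp≡β = φ-surjective 2≤m 0<n n<m^1+j α rep β (𝓢⇒admissible β∈𝓢)
    in p , λ z≡p → trans (cong (φ α) z≡p) φp≡β
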